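{- Let $a,b$ be non-zero real numbers, let $(J_n)_{n\ge 0}$ be the bi-periodic Jacobsthal matrix sequence and $(j_n)_{n\ge -1}$ the bi-periodic Jacobsthal sequence associated with $a,b$. Then for every integer $n\ge 0$, $$J_n=\begin{pmatrix} \left(\frac{b}{a}\right)^{\varepsilon(n)} j_{n+1} & 2\frac{b}{a}\, j_n\\[2pt] j_n & 2\left(\frac{b}{a}\right)^{\varepsilon(n)} j_{n-1}\end{pmatrix}.$$
   Context: Fix non-zero real numbers $a,b$. The parity function is $\varepsilon(n)=0$ if $n$ is even and $\varepsilon(n)=1$ if $n$ is odd. The bi-periodic Jacobsthal matrix sequence $(J_n)_{n\ge 0}$ of $2\times 2$ real matrices is defined by $J_0=\begin{pmatrix}1&0\\0&1\end{pmatrix}$, $J_1=\begin{pmatrix} b & 2\frac{b}{a}\\ 1&0\end{pmatrix}$, and for $n\ge 2$: $J_n=aJ_{n-1}+2J_{n-2}$ if $n$ is even, $J_n=bJ_{n-1}+2J_{n-2}$ if $n$ is odd. The (scalar) bi-periodic Jacobsthal sequence is defined by $j_0=0$, $j_1=1$, and for $n\ge 2$: $j_n=aj_{n-1}+2j_{n-2}$ if $n$ is even, $j_n=bj_{n-1}+2j_{n-2}$ if $n$ is odd. By convention $j_{ -1}=\frac12$. -}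

module Defs where

open import Algebra.Bundles using (CommutativeRing; RawRing)
import Algebra.Definitions.RawSemiring as RawSemiringDefinitions
open import Data.Nat.Base as ℕ using (ℕ; zero; suc; parity)
import Data.Nat.Properties as ℕ
open import Data.Parity.Base using (0ℙ; 1ℙ)
open import Data.Product.Base using (∃; _×_; _,_; proj₁; proj₂)
open import Data.Rational.Base as ℚ using (ℚ; 0ℚ; 1ℚ; ½; ∣_∣)
import Data.Rational.Properties as ℚ
open import Data.Rational.Solver using (module +-*-Solver)
open import Data.Unit.Base using (⊤)
open import Data.Vec.Functional using (Vector; []; _∷_; map; zipWith)
open import Data.Vec.Functional.Relation.Binary.Pointwise using (Pointwise)
open import Level using (0ℓ)
open import Relation.Binary.PropositionalEquality
  using (_≡_; _≢_; refl; sym; trans; cong; cong₂; subst; subst₂; module ≡-Reasoning)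
open import Relation.Nullary.Decidable.Core using (yes; no)
open import Relation.Nullary.Negation using (contradiction)

private

  0<½ : 0ℚ ℚ.< ½
  0<½ = ℚ.positive⁻¹ ½

  0<1 : 0ℚ ℚ.< 1ℚ
  0<1 = ℚ.positive⁻¹ 1ℚ

  0<* : ∀ {p q} → 0ℚ ℚ.< p → 0ℚ ℚ.< q → 0ℚ ℚ.< p ℚ.* q
  0<* {p} {q} 0<p 0<q = subst (ℚ._< p ℚ.* q) (ℚ.*-zeroʳ p)
    (ℚ.*-monoʳ-<-pos p {{ℚ.positive 0<p}} 0<q)

  0<1/ : ∀ {p} (0<p : 0ℚ ℚ.< p) → 0ℚ ℚ.< (ℚ.1/ p) {{ℚ.>-nonZero 0<p}}
  0<1/ {p} 0<p = ℚ.positive⁻¹ _ {{ℚ.1/pos⇒pos p {{ℚ.positive 0<p}}}}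

  *-mono-≤ : ∀ {p q r s} → 0ℚ ℚ.≤ p → 0ℚ ℚ.≤ s →
             p ℚ.≤ q → r ℚ.≤ s → p ℚ.* r ℚ.≤ q ℚ.* s
  *-mono-≤ {p} {q} {r} {s} 0≤p 0≤s p≤q r≤s = ℚ.≤-trans
    (ℚ.*-monoˡ-≤-nonNeg p {{ℚ.nonNegative 0≤p}} r≤s)
    (ℚ.*-monoʳ-≤-nonNeg s {{ℚ.nonNegative 0≤s}} p≤q)

  splitting : ∀ {K e} → 0ℚ ℚ.< K → 0ℚ ℚ.< e →
              ∃ λ d → 0ℚ ℚ.< d × K ℚ.* (d ℚ.+ d) ≡ e
  splitting {K} {e} 0<K 0<e = d , 0<* (0<* (0<1/ 0<K) 0<e) 0<½ , K[d+d]≡e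
    where
    instance _ = ℚ.>-nonZero 0<K
    d = ℚ.1/ K ℚ.* e ℚ.* ½
    K[d+d]≡e : K ℚ.* (d ℚ.+ d) ≡ e
    K[d+d]≡e = begin
      K ℚ.* (d ℚ.+ d)   ≡⟨ solve 3 (λ k l f → k :* (l :* f :* con ½ :+ l :* f :* con ½) := k :* l :* f) refl K (ℚ.1/ K) e ⟩
      K ℚ.* ℚ.1/ K ℚ.* e ≡⟨ cong (ℚ._* e) (ℚ.*-inverseʳ K) ⟩
      1ℚ ℚ.* e          ≡⟨ ℚ.*-identityˡ e ⟩
      e                 ∎
      where open ≡-Reasoning
            open +-*-Solver

  ∣p-q∣≡∣q-p∣ : ∀ p q → ∣ p ℚ.- q ∣ ≡ ∣ q ℚ.- p ∣
  ∣p-q∣≡∣q-p∣ p q = trans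
    (cong ∣_∣ (solve 2 (λ p q → p :- q := :- (q :- p)) refl p q))
    (ℚ.∣-p∣≡∣p∣ (q ℚ.- p))
    where open +-*-Solver

  ∣-p--q∣≡ : ∀ p q → ∣ p ℚ.- q ∣ ≡ ∣ (ℚ.- p) ℚ.- (ℚ.- q) ∣
  ∣-p--q∣≡ p q = trans (∣p-q∣≡∣q-p∣ p q)
    (cong ∣_∣ (solve 2 (λ p q → q :- p := (:- p) :- (:- q)) refl p q))
    where open +-*-Solver

  ∣p-r∣≤ : ∀ p q r → ∣ p ℚ.- r ∣ ℚ.≤ ∣ p ℚ.- q ∣ ℚ.+ ∣ q ℚ.- r ∣
  ∣p-r∣≤ p q r = subst (λ t → ∣ t ∣ ℚ.≤ ∣ p ℚ.- q ∣ ℚ.+ ∣ q ℚ.- r ∣)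
    (solve 3 (λ p q r → (p :- q) :+ (q :- r) := p :- r) refl p q r)
    (ℚ.∣p+q∣≤∣p∣+∣q∣ (p ℚ.- q) (q ℚ.- r))
    where open +-*-Solver

  +-estimate : ∀ p q r s → ∣ (p ℚ.+ q) ℚ.- (r ℚ.+ s) ∣ ℚ.≤
                           1ℚ ℚ.* (∣ p ℚ.- r ∣ ℚ.+ ∣ q ℚ.- s ∣)
  +-estimate p q r s = subst₂ ℚ._≤_
    (cong ∣_∣ (solve 4 (λ p q r s → (p :- r) :+ (q :- s) := (p :+ q) :- (r :+ s)) refl p q r s))
    (sym (ℚ.*-identityˡ _))
    (ℚ.∣p+q∣≤∣p∣+∣q∣ (p ℚ.- r) (q ℚ.- s))
    where open +-*-Solver

  *-estimate : ∀ {B} p q r s → ∣ p ∣ ℚ.≤ B → ∣ s ∣ ℚ.≤ B →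
               ∣ p ℚ.* q ℚ.- r ℚ.* s ∣ ℚ.≤ B ℚ.* (∣ p ℚ.- r ∣ ℚ.+ ∣ q ℚ.- s ∣)
  *-estimate {B} p q r s p≤B s≤B = begin
    ∣ p ℚ.* q ℚ.- r ℚ.* s ∣
      ≡⟨ cong ∣_∣ (solve 4 (λ p q r s → p :* q :- r :* s := s :* (p :- r) :+ p :* (q :- s)) refl p q r s) ⟩
    ∣ s ℚ.* (p ℚ.- r) ℚ.+ p ℚ.* (q ℚ.- s) ∣
      ≤⟨ ℚ.∣p+q∣≤∣p∣+∣q∣ (s ℚ.* (p ℚ.- r)) (p ℚ.* (q ℚ.- s)) ⟩
    ∣ s ℚ.* (p ℚ.- r) ∣ ℚ.+ ∣ p ℚ.* (q ℚ.- s) ∣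
      ≡⟨ cong₂ ℚ._+_ (ℚ.∣p*q∣≡∣p∣*∣q∣ s _) (ℚ.∣p*q∣≡∣p∣*∣q∣ p _) ⟩
    ∣ s ∣ ℚ.* ∣ p ℚ.- r ∣ ℚ.+ ∣ p ∣ ℚ.* ∣ q ℚ.- s ∣
      ≤⟨ ℚ.+-mono-≤ (*-mono-≤ (ℚ.0≤∣p∣ s) (ℚ.0≤∣p∣ (p ℚ.- r)) s≤B ℚ.≤-refl)
                    (*-mono-≤ (ℚ.0≤∣p∣ p) (ℚ.0≤∣p∣ (q ℚ.- s)) p≤B ℚ.≤-refl) ⟩
    B ℚ.* ∣ p ℚ.- r ∣ ℚ.+ B ℚ.* ∣ q ℚ.- s ∣
      ≡⟨ ℚ.*-distribˡ-+ B _ _ ⟨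
    B ℚ.* (∣ p ℚ.- r ∣ ℚ.+ ∣ q ℚ.- s ∣) ∎
    where open ℚ.≤-Reasoning
          open +-*-Solver

-- The reciprocal extended by recip 0 = 0, so that it can be applied to
-- every term of a sequence.

recip : ℚ → ℚ
recip p with p ℚ.≟ 0ℚ
... | yes _   = 0ℚ
... | no  p≢0 = (ℚ.1/ p) {{ℚ.≢-nonZero p≢0}}

private

  recip-inverseʳ : ∀ {p} → p ≢ 0ℚ → p ℚ.* recip p ≡ 1ℚ
  recip-inverseʳ {p} p≢0 with p ℚ.≟ 0ℚ
  ... | yes p≡0 = contradiction p≡0 p≢0
  ... | no  _   = ℚ.*-inverseʳ p {{ℚ.≢-nonZero p≢0}}

  ≤∣∣⇒≢0 : ∀ {d p} → 0ℚ ℚ.< d → d ℚ.≤ ∣ p ∣ → p ≢ 0ℚ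
  ≤∣∣⇒≢0 0<d d≤∣p∣ refl = ℚ.<-irrefl refl (ℚ.<-≤-trans 0<d d≤∣p∣)

  recip-bound : ∀ {d p} (0<d : 0ℚ ℚ.< d) → d ℚ.≤ ∣ p ∣ →
                ∣ recip p ∣ ℚ.≤ (ℚ.1/ d) {{ℚ.>-nonZero 0<d}}
  recip-bound {d} {p} 0<d d≤∣p∣ = ℚ.*-cancelˡ-≤-pos d {{ℚ.positive 0<d}} (begin
    d ℚ.* ∣ recip p ∣      ≤⟨ *-mono-≤ (ℚ.<⇒≤ 0<d) (ℚ.0≤∣p∣ (recip p)) d≤∣p∣ ℚ.≤-refl ⟩
    ∣ p ∣ ℚ.* ∣ recip p ∣  ≡⟨ ℚ.∣p*q∣≡∣p∣*∣q∣ p (recip p) ⟨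
    ∣ p ℚ.* recip p ∣      ≡⟨ cong ∣_∣ (recip-inverseʳ (≤∣∣⇒≢0 0<d d≤∣p∣)) ⟩
    1ℚ                     ≡⟨ ℚ.*-inverseʳ d ⟨
    d ℚ.* ℚ.1/ d           ∎)
    where open ℚ.≤-Reasoning
          instance _ = ℚ.>-nonZero 0<d

  recip-estimate : ∀ {d p q} (0<d : 0ℚ ℚ.< d) → d ℚ.≤ ∣ p ∣ → d ℚ.≤ ∣ q ∣ →
                   let D = (ℚ.1/ d) {{ℚ.>-nonZero 0<d}} in
                   ∣ recip p ℚ.- recip q ∣ ℚ.≤
                   (D ℚ.* D) ℚ.* (∣ p ℚ.- q ∣ ℚ.+ ∣ p ℚ.- q ∣)
  recip-estimate {d} {p} {q} 0<d d≤∣p∣ d≤∣q∣ = begin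
    ∣ P ℚ.- Q ∣
      ≡⟨ cong ∣_∣ P-Q≡ ⟩
    ∣ (P ℚ.* Q) ℚ.* (q ℚ.- p) ∣
      ≡⟨ trans (ℚ.∣p*q∣≡∣p∣*∣q∣ (P ℚ.* Q) _) (cong₂ ℚ._*_ (ℚ.∣p*q∣≡∣p∣*∣q∣ P Q) (∣p-q∣≡∣q-p∣ q p)) ⟩
    (∣ P ∣ ℚ.* ∣ Q ∣) ℚ.* ∣ p ℚ.- q ∣
      ≤⟨ *-mono-≤ (ℚ.≤-trans (ℚ.≤-reflexive (sym (ℚ.*-zeroˡ ∣ Q ∣))) (*-mono-≤ ℚ.≤-refl (ℚ.0≤∣p∣ Q) (ℚ.0≤∣p∣ P) ℚ.≤-refl))
                  (ℚ.≤-trans (ℚ.0≤∣p∣ (p ℚ.- q)) pq≤)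
                  (*-mono-≤ (ℚ.0≤∣p∣ P) (ℚ.<⇒≤ (0<1/ 0<d)) (recip-bound 0<d d≤∣p∣) (recip-bound 0<d d≤∣q∣))
                  pq≤ ⟩
    (D ℚ.* D) ℚ.* (∣ p ℚ.- q ∣ ℚ.+ ∣ p ℚ.- q ∣) ∎
    where
    open ℚ.≤-Reasoning
    open +-*-Solver
    P Q D : ℚ
    P = recip p
    Q = recip q
    D = (ℚ.1/ d) {{ℚ.>-nonZero 0<d}}
    pq≤ : ∣ p ℚ.- q ∣ ℚ.≤ ∣ p ℚ.- q ∣ ℚ.+ ∣ p ℚ.- q ∣
    pq≤ = ℚ.≤-trans (ℚ.≤-reflexive (sym (ℚ.+-identityʳ _)))
                    (ℚ.+-monoʳ-≤ ∣ p ℚ.- q ∣ (ℚ.0≤∣p∣ (p ℚ.- q)))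
    P-Q≡ : P ℚ.- Q ≡ (P ℚ.* Q) ℚ.* (q ℚ.- p)
    P-Q≡ = begin-equality
      P ℚ.- Q
        ≡⟨ cong₂ ℚ._-_ (ℚ.*-identityʳ P) (ℚ.*-identityʳ Q) ⟨
      P ℚ.* 1ℚ ℚ.- Q ℚ.* 1ℚ
        ≡⟨ cong₂ (λ s t → P ℚ.* s ℚ.- Q ℚ.* t) (recip-inverseʳ (≤∣∣⇒≢0 0<d d≤∣q∣)) (recip-inverseʳ (≤∣∣⇒≢0 0<d d≤∣p∣)) ⟨
      P ℚ.* (q ℚ.* Q) ℚ.- Q ℚ.* (p ℚ.* P)
        ≡⟨ solve 4 (λ P Q p q → P :* (q :* Q) :- Q :* (p :* P) := (P :* Q) :* (q :- p)) refl P Q p q ⟩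
      (P ℚ.* Q) ℚ.* (q ℚ.- p) ∎

Eventually : (ℕ → Set) → Set
Eventually P = ∃ λ N → ∀ n → N ℕ.≤ n → P n

-- ℝ is the setoid of Cauchy sequences of rationals, with x ≈ y when the
-- difference is a null sequence. The operations act termwise.

record ℝ : Set where
  no-eta-equality
  field
    seq    : ℕ → ℚ
    cauchy : ∀ {e} → 0ℚ ℚ.< e →
             ∃ λ N → ∀ m n → N ℕ.≤ m → N ℕ.≤ n → ∣ seq m ℚ.- seq n ∣ ℚ.< e

open ℝ public

infix 4 _≈_ _#_

record _≈_ (x y : ℝ) : Set where
  no-eta-equality
  constructor mk≈
  field
    close : ∀ {e} → 0ℚ ℚ.< e → Eventually λ n → ∣ seq x n ℚ.- seq y n ∣ ℚ.< e

open _≈_ public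

-- Apartness is the constructive form of x ≠ y: classically it is
-- equivalent to ¬ x ≈ y, and it is what makes x - y invertible.

_#_ : ℝ → ℝ → Set
x # y = ∃ λ d → 0ℚ ℚ.< d × Eventually λ n → d ℚ.≤ ∣ seq x n ℚ.- seq y n ∣

private

  both : ∀ {P Q} → Eventually P → Eventually Q → Eventually λ n → P n × Q n
  both (M , p) (N , q) = M ℕ.⊔ N , λ n M⊔N≤n →
    p n (ℕ.≤-trans (ℕ.m≤m⊔n M N) M⊔N≤n) , q n (ℕ.≤-trans (ℕ.m≤n⊔m M N) M⊔N≤n)

  bound-< : ∀ {K a b d e t} → 0ℚ ℚ.< K → K ℚ.* (d ℚ.+ d) ≡ e →
            a ℚ.< d → b ℚ.< d → t ℚ.≤ K ℚ.* (a ℚ.+ b) → t ℚ.< e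
  bound-< {K} {d = d} 0<K eq a<d b<d t≤ = subst (_ ℚ.<_) eq (ℚ.≤-<-trans t≤
    (ℚ.*-monoʳ-<-pos K {{ℚ.positive 0<K}} (ℚ.+-mono-< a<d b<d)))

  -- A sequence that eventually moves by at most a constant multiple of
  -- the movements of x and y is itself Cauchy.
  dominated : ∀ (x y : ℝ) (z : ℕ → ℚ) {K} {P : ℕ → Set} → 0ℚ ℚ.< K → Eventually P →
    (∀ m n → P m → P n → ∣ z m ℚ.- z n ∣ ℚ.≤
      K ℚ.* (∣ seq x m ℚ.- seq x n ∣ ℚ.+ ∣ seq y m ℚ.- seq y n ∣)) →
    ∀ {e} → 0ℚ ℚ.< e →
    ∃ λ N → ∀ m n → N ℕ.≤ m → N ℕ.≤ n → ∣ z m ℚ.- z n ∣ ℚ.< e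
  dominated x y z 0<K (N₀ , p) z≤ 0<e =
    let d , 0<d , eq = splitting 0<K 0<e
        N₁ , x-close = cauchy x 0<d
        N₂ , y-close = cauchy y 0<d
        N = N₀ ℕ.⊔ (N₁ ℕ.⊔ N₂)
        N₀≤ : N₀ ℕ.≤ N
        N₀≤ = ℕ.m≤m⊔n N₀ _
        N₁≤ : N₁ ℕ.≤ N
        N₁≤ = ℕ.≤-trans (ℕ.m≤m⊔n N₁ N₂) (ℕ.m≤n⊔m N₀ _)
        N₂≤ : N₂ ℕ.≤ N
        N₂≤ = ℕ.≤-trans (ℕ.m≤n⊔m N₁ N₂) (ℕ.m≤n⊔m N₀ _)
    in N , λ m n N≤m N≤n → bound-< 0<K eq
      (x-close m n (ℕ.≤-trans N₁≤ N≤m) (ℕ.≤-trans N₁≤ N≤n))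
      (y-close m n (ℕ.≤-trans N₂≤ N≤m) (ℕ.≤-trans N₂≤ N≤n))
      (z≤ m n (p m (ℕ.≤-trans N₀≤ N≤m)) (p n (ℕ.≤-trans N₀≤ N≤n)))

  dominated-≈ : ∀ {x x′ y y′ z z′ : ℝ} {K} {P : ℕ → Set} → 0ℚ ℚ.< K → Eventually P →
    x ≈ x′ → y ≈ y′ →
    (∀ n → P n → ∣ seq z n ℚ.- seq z′ n ∣ ℚ.≤
      K ℚ.* (∣ seq x n ℚ.- seq x′ n ∣ ℚ.+ ∣ seq y n ℚ.- seq y′ n ∣)) →
    z ≈ z′
  dominated-≈ 0<K evP x≈x′ y≈y′ z≤ = mk≈ λ 0<e →
    let d , 0<d , eq = splitting 0<K 0<e
        N , h = both evP (both (close x≈x′ 0<d) (close y≈y′ 0<d))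
    in N , λ n N≤n → let p , u , v = h n N≤n in bound-< 0<K eq u v (z≤ n p)

  trivially : Eventually λ _ → ⊤
  trivially = 0 , _

  bounded : ∀ x → ∃ λ B → 0ℚ ℚ.< B × Eventually λ n → ∣ seq x n ∣ ℚ.≤ B
  bounded x = B , 0<B , N , λ n N≤n → begin
      ∣ seq x n ∣
        ≡⟨ cong ∣_∣ (solve 2 (λ p q → p := (p :- q) :+ q) refl (seq x n) (seq x N)) ⟩
      ∣ (seq x n ℚ.- seq x N) ℚ.+ seq x N ∣
        ≤⟨ ℚ.∣p+q∣≤∣p∣+∣q∣ (seq x n ℚ.- seq x N) (seq x N) ⟩
      ∣ seq x n ℚ.- seq x N ∣ ℚ.+ ∣ seq x N ∣
        ≤⟨ ℚ.+-monoˡ-≤ _ (ℚ.<⇒≤ (proj₂ (cauchy x 0<1) n N N≤n ℕ.≤-refl)) ⟩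
      B ∎
    where
    open ℚ.≤-Reasoning
    open +-*-Solver
    N = proj₁ (cauchy x 0<1)
    B = 1ℚ ℚ.+ ∣ seq x N ∣
    0<B : 0ℚ ℚ.< B
    0<B = ℚ.+-mono-<-≤ 0<1 (ℚ.0≤∣p∣ (seq x N))

  bounded₂ : ∀ x y → ∃ λ B → 0ℚ ℚ.< B ×
             Eventually λ n → ∣ seq x n ∣ ℚ.≤ B × ∣ seq y n ∣ ℚ.≤ B
  bounded₂ x y =
    let B , 0<B , evx = bounded x
        C , 0<C , evy = bounded y
        N , h = both evx evy
        B≤ : B ℚ.≤ B ℚ.+ C
        B≤ = subst (ℚ._≤ B ℚ.+ C) (ℚ.+-identityʳ B) (ℚ.+-monoʳ-≤ B (ℚ.<⇒≤ 0<C))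
        C≤ : C ℚ.≤ B ℚ.+ C
        C≤ = subst (ℚ._≤ B ℚ.+ C) (ℚ.+-identityˡ C) (ℚ.+-monoˡ-≤ C (ℚ.<⇒≤ 0<B))
    in B ℚ.+ C , ℚ.+-mono-< 0<B 0<C , N , λ n N≤n →
       ℚ.≤-trans (proj₁ (h n N≤n)) B≤ , ℚ.≤-trans (proj₂ (h n N≤n)) C≤

infix  8 -_
infixl 7 _*_
infixl 6 _+_

fromℚ : ℚ → ℝ
seq    (fromℚ p) n   = p
cauchy (fromℚ p) 0<e = 0 , λ _ _ _ _ →
  subst (λ t → ∣ t ∣ ℚ.< _) (sym (ℚ.+-inverseʳ p)) 0<e

_+_ : ℝ → ℝ → ℝ
seq    (x + y) n = seq x n ℚ.+ seq y n
cauchy (x + y)   = dominated x y (λ n → seq x n ℚ.+ seq y n) 0<1 trivially λ m n _ _ →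
  +-estimate (seq x m) (seq y m) (seq x n) (seq y n)

_*_ : ℝ → ℝ → ℝ
seq    (x * y) n = seq x n ℚ.* seq y n
cauchy (x * y)   = let B , 0<B , ev = bounded₂ x y in
  dominated x y (λ n → seq x n ℚ.* seq y n) 0<B ev λ m n p q →
    *-estimate (seq x m) (seq y m) (seq x n) (seq y n) (proj₁ p) (proj₂ q)

-_ : ℝ → ℝ
seq    (- x) n   = ℚ.- seq x n
cauchy (- x) 0<e = let N , h = cauchy x 0<e in
  N , λ m n N≤m N≤n → subst (ℚ._< _) (∣-p--q∣≡ (seq x m) (seq x n)) (h m n N≤m N≤n)

0ℝ 1ℝ 2ℝ ½ℝ : ℝ
0ℝ = fromℚ 0ℚ
1ℝ = fromℚ 1ℚ
2ℝ = fromℚ (1ℚ ℚ.+ 1ℚ)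
½ℝ = fromℚ ½

private

  #0⇒≤ : ∀ x ((d , _) : x # 0ℝ) → Eventually λ n → d ℚ.≤ ∣ seq x n ∣
  #0⇒≤ x (d , _ , N , h) = N , λ n N≤n →
    subst (λ t → d ℚ.≤ ∣ t ∣) (ℚ.+-identityʳ (seq x n)) (h n N≤n)

inverse : ∀ x → x # 0ℝ → ℝ
seq    (inverse x x#0) n = recip (seq x n)
cauchy (inverse x x#0@(d , 0<d , _)) =
  dominated x x (λ n → recip (seq x n)) (0<* (0<1/ 0<d) (0<1/ 0<d)) (#0⇒≤ x x#0)
    λ m n → recip-estimate {p = seq x m} {seq x n} 0<d

infixl 7 divide
divide : ∀ x y → y # 0ℝ → ℝ
divide x y y#0 = x * inverse y y#0

syntax divide x y y#0 = x ÷ y [ y#0 ]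

private

  pointwise : ∀ {x y} → (∀ n → seq x n ≡ seq y n) → x ≈ y
  pointwise {x} {y} x≡y = mk≈ λ 0<e → 0 , λ n _ →
    subst (λ t → ∣ t ∣ ℚ.< _)
      (sym (trans (cong (ℚ._- seq y n) (x≡y n)) (ℚ.+-inverseʳ (seq y n)))) 0<e

inverseʳ : ∀ x (x#0 : x # 0ℝ) → x * inverse x x#0 ≈ 1ℝ
inverseʳ x x#0@(_ , 0<d , _) = mk≈ λ 0<e →
  let N , h = #0⇒≤ x x#0 in
  N , λ n N≤n → subst (λ t → ∣ t ∣ ℚ.< _)
    (sym (cong (ℚ._- 1ℚ) (recip-inverseʳ (≤∣∣⇒≢0 0<d (h n N≤n))))) 0<e

private

  ≈-refl : ∀ {x} → x ≈ x
  ≈-refl = pointwise λ _ → refl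

  ≈-sym : ∀ {x y} → x ≈ y → y ≈ x
  ≈-sym {x} {y} x≈y = mk≈ λ 0<e → let N , h = close x≈y 0<e in
    N , λ n N≤n → subst (ℚ._< _) (∣p-q∣≡∣q-p∣ (seq x n) (seq y n)) (h n N≤n)

  ≈-trans : ∀ {x y z} → x ≈ y → y ≈ z → x ≈ z
  ≈-trans {x} {y} {z} x≈y y≈z = dominated-≈ 0<1 trivially x≈y y≈z
    λ n _ → subst (_ ℚ.≤_) (sym (ℚ.*-identityˡ _)) (∣p-r∣≤ (seq x n) (seq y n) (seq z n))

  +-cong : ∀ {x x′ y y′} → x ≈ x′ → y ≈ y′ → x + y ≈ x′ + y′
  +-cong {x} {x′} {y} {y′} x≈x′ y≈y′ = dominated-≈ 0<1 trivially x≈x′ y≈y′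
    λ n _ → +-estimate (seq x n) (seq y n) (seq x′ n) (seq y′ n)

  *-cong : ∀ {x x′ y y′} → x ≈ x′ → y ≈ y′ → x * y ≈ x′ * y′
  *-cong {x} {x′} {y} {y′} x≈x′ y≈y′ =
    let B , 0<B , ev = bounded₂ x y′ in
    dominated-≈ 0<B ev x≈x′ y≈y′ λ n p →
      *-estimate (seq x n) (seq y n) (seq x′ n) (seq y′ n) (proj₁ p) (proj₂ p)

  -‿cong : ∀ {x x′} → x ≈ x′ → - x ≈ - x′
  -‿cong {x} {x′} x≈x′ = mk≈ λ 0<e → let N , h = close x≈x′ 0<e in
    N , λ n N≤n → subst (ℚ._< _) (∣-p--q∣≡ (seq x n) (seq x′ n)) (h n N≤n)

  +-assoc : ∀ x y z → (x + y) + z ≈ x + (y + z)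
  +-assoc x y z = pointwise λ n → ℚ.+-assoc (seq x n) (seq y n) (seq z n)

  +-comm : ∀ x y → x + y ≈ y + x
  +-comm x y = pointwise λ n → ℚ.+-comm (seq x n) (seq y n)

  +-identityˡ : ∀ x → 0ℝ + x ≈ x
  +-identityˡ x = pointwise λ n → ℚ.+-identityˡ (seq x n)

  +-identityʳ : ∀ x → x + 0ℝ ≈ x
  +-identityʳ x = pointwise λ n → ℚ.+-identityʳ (seq x n)

  +-inverseˡ : ∀ x → - x + x ≈ 0ℝ
  +-inverseˡ x = pointwise λ n → ℚ.+-inverseˡ (seq x n)

  +-inverseʳ : ∀ x → x + - x ≈ 0ℝ
  +-inverseʳ x = pointwise λ n → ℚ.+-inverseʳ (seq x n)

  *-assoc : ∀ x y z → (x * y) * z ≈ x * (y * z)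
  *-assoc x y z = pointwise λ n → ℚ.*-assoc (seq x n) (seq y n) (seq z n)

  *-comm : ∀ x y → x * y ≈ y * x
  *-comm x y = pointwise λ n → ℚ.*-comm (seq x n) (seq y n)

  *-identityˡ : ∀ x → 1ℝ * x ≈ x
  *-identityˡ x = pointwise λ n → ℚ.*-identityˡ (seq x n)

  *-identityʳ : ∀ x → x * 1ℝ ≈ x
  *-identityʳ x = pointwise λ n → ℚ.*-identityʳ (seq x n)

  *-distribˡ-+ : ∀ x y z → x * (y + z) ≈ x * y + x * z
  *-distribˡ-+ x y z = pointwise λ n → ℚ.*-distribˡ-+ (seq x n) (seq y n) (seq z n)

  *-distribʳ-+ : ∀ x y z → (y + z) * x ≈ y * x + z * x
  *-distribʳ-+ x y z = pointwise λ n → ℚ.*-distribʳ-+ (seq x n) (seq y n) (seq z n)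

ℝ-commutativeRing : CommutativeRing 0ℓ 0ℓ
ℝ-commutativeRing = record
  { Carrier = ℝ
  ; _≈_     = _≈_
  ; _+_     = _+_
  ; _*_     = _*_
  ; -_      = -_
  ; 0#      = 0ℝ
  ; 1#      = 1ℝ
  ; isCommutativeRing = record
    { isRing = record
      { +-isAbelianGroup = record
        { isGroup = record
          { isMonoid = record
            { isSemigroup = record
              { isMagma = record
                { isEquivalence = record { refl = ≈-refl ; sym = ≈-sym ; trans = ≈-trans }
                ; ∙-cong = +-cong
                }
              ; assoc = +-assoc
              }
            ; identity = +-identityˡ , +-identityʳ
            }
          ; inverse = +-inverseˡ , +-inverseʳ
          ; ⁻¹-cong = -‿cong
          }
        ; comm = +-comm
        }
      ; *-cong = *-cong
      ; *-assoc = *-assoc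
      ; *-identity = *-identityˡ , *-identityʳ
      ; distrib = *-distribˡ-+ , *-distribʳ-+
      }
    ; *-comm = *-comm
    }
  }

open RawSemiringDefinitions (RawRing.rawSemiring (CommutativeRing.rawRing ℝ-commutativeRing)) public
  using (_^_)

Matrix : ℕ → ℕ → Set
Matrix m n = Vector (Vector ℝ n) m

infix  4 _≈ᴹ_
infixl 6 _+ᴹ_
infixl 7 _·ᴹ_

_≈ᴹ_ : ∀ {m n} → Matrix m n → Matrix m n → Set
_≈ᴹ_ = Pointwise (Pointwise _≈_)

_+ᴹ_ : ∀ {m n} → Matrix m n → Matrix m n → Matrix m n
_+ᴹ_ = zipWith (zipWith _+_)

_·ᴹ_ : ∀ {m n} → ℝ → Matrix m n → Matrix m n
c ·ᴹ A = map (map (c *_)) A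

matrix₂ : ℝ → ℝ → ℝ → ℝ → Matrix 2 2
matrix₂ p q r s = (p ∷ q ∷ []) ∷ (r ∷ s ∷ []) ∷ []

ε : ℕ → ℕ
ε n with parity n
... | 0ℙ = 0
... | 1ℙ = 1

coefficient : ℝ → ℝ → ℕ → ℝ
coefficient a b n with parity n
... | 0ℙ = a
... | 1ℙ = b

j : ℝ → ℝ → ℕ → ℝ
j a b 0               = 0ℝ
j a b 1               = 1ℝ
j a b n@(suc (suc m)) = coefficient a b n * j a b (suc m) + 2ℝ * j a b m

-- j-pred a b n is jₙ₋₁, with the convention j₋₁ = 1/2.

j-pred : ℝ → ℝ → ℕ → ℝ
j-pred a b zero    = ½ℝ
j-pred a b (suc n) = j a b n

J : ∀ a b → a # 0ℝ → ℕ → Matrix 2 2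
J a b a#0 0 = matrix₂ 1ℝ 0ℝ
                      0ℝ 1ℝ
J a b a#0 1 = matrix₂ b  (2ℝ * (b ÷ a [ a#0 ]))
                      1ℝ 0ℝ
J a b a#0 n@(suc (suc m)) = coefficient a b n ·ᴹ J a b a#0 (suc m) +ᴹ 2ℝ ·ᴹ J a b a#0 m

{-# OPTIONS --safe #-}

-- Every entry of Jₙ satisfies the recurrence xₙ₊₂ = cₙ₊₂ xₙ₊₁ + 2 xₙ, where cₙ is
-- a or b according to the parity of n, and so is determined by its first two
-- values. The off-diagonal entries of the claimed matrix are multiples of jₙ. The
-- diagonal ones are multiples of (b/a)^ε(n) times a shift of j by one, which
-- satisfies the recurrence with a and b interchanged; since
-- (b/a)^ε(n) cₙ₊₁ = cₙ (b/a)^ε(n+1), the factor (b/a)^ε(n) interchanges them back.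

module Submission where

open import Defs
open import Algebra.Bundles using (CommutativeRing)
open import Algebra.Solver.Ring.NaturalCoefficients.Default
  (CommutativeRing.commutativeSemiring ℝ-commutativeRing)
  using (solve; _:=_; _:+_; _:*_; con)
open import Data.Fin.Base using (zero; suc)
open import Data.Nat.Base using (ℕ; zero; suc)
open import Data.Product.Base using (_,_)
import Relation.Binary.Reasoning.Setoid as SetoidReasoning

open CommutativeRing ℝ-commutativeRing
  using (setoid; +-cong; +-congʳ; *-congˡ; *-congʳ)
  renaming (refl to ≈-refl; sym to ≈-sym; trans to ≈-trans)
open SetoidReasoning setoid

-- The coefficient is read at `n`, not `n + 2`: `parity` drops two successors by computation, so
-- `coefficient a b` has period two definitionally and defining equations become instances by
-- `≈-refl`.
Recurrence : (ℕ → ℝ) → (ℕ → ℝ) → Set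
Recurrence c x = ∀ n → x (suc (suc n)) ≈ c n * x (suc n) + 2ℝ * x n

recurrence-unique : ∀ {c x y : ℕ → ℝ} → Recurrence c x → Recurrence c y →
                    x 0 ≈ y 0 → x 1 ≈ y 1 → ∀ n → x n ≈ y n
recurrence-unique rx ry x₀≈y₀ x₁≈y₁ zero          = x₀≈y₀
recurrence-unique rx ry x₀≈y₀ x₁≈y₁ (suc zero)    = x₁≈y₁
recurrence-unique {c} {x} {y} rx ry x₀≈y₀ x₁≈y₁ (suc (suc n)) = begin
  x (suc (suc n))                ≈⟨ rx n ⟩
  c n * x (suc n) + 2ℝ * x n     ≈⟨ +-cong (*-congˡ (ih (suc n))) (*-congˡ (ih n)) ⟩
  c n * y (suc n) + 2ℝ * y n     ≈⟨ ry n ⟨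
  y (suc (suc n))                ∎
  where ih = recurrence-unique {c} {x} {y} rx ry x₀≈y₀ x₁≈y₁

recurrence-scale : ∀ {c x} k → Recurrence c x → Recurrence c (λ n → k * x n)
recurrence-scale {c} {x} k rx n = ≈-trans (*-congˡ (rx n))
  (solve 5 (λ k c t x₁ x₀ → k :* (c :* x₁ :+ t :* x₀) := c :* (k :* x₁) :+ t :* (k :* x₀))
    ≈-refl k (c n) 2ℝ (x (suc n)) (x n))

-- Periodicity puts the weight `w n` in front of both terms; moving it past the coefficient turns
-- `d n` into `c n` and advances the weight to `w (suc n)`, as `x (suc n)` requires.
recurrence-twist : ∀ {c d w x : ℕ → ℝ} → (∀ n → w (suc (suc n)) ≈ w n) →
                   (∀ n → w n * d n ≈ c n * w (suc n)) →
                   Recurrence d x → Recurrence c (λ n → w n * x n)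
recurrence-twist {c} {d} {w} {x} periodic intertwines rx n = begin
  w (suc (suc n)) * x (suc (suc n))
    ≈⟨ *-congʳ (periodic n) ⟩
  w n * x (suc (suc n))
    ≈⟨ *-congˡ (rx n) ⟩
  w n * (d n * x (suc n) + 2ℝ * x n)
    ≈⟨ solve 5 (λ w d t x₁ x₀ → w :* (d :* x₁ :+ t :* x₀) := (w :* d) :* x₁ :+ t :* (w :* x₀))
         ≈-refl (w n) (d n) 2ℝ (x (suc n)) (x n) ⟩
  (w n * d n) * x (suc n) + 2ℝ * (w n * x n)
    ≈⟨ +-congʳ (*-congʳ (intertwines n)) ⟩
  (c n * w (suc n)) * x (suc n) + 2ℝ * (w n * x n)
    ≈⟨ +-congʳ (solve 3 (λ c w x → (c :* w) :* x := c :* (w :* x))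
         ≈-refl (c n) (w (suc n)) (x (suc n))) ⟩
  c n * (w (suc n) * x (suc n)) + 2ℝ * (w n * x n) ∎

2*½≈1 : 2ℝ * ½ℝ ≈ 1ℝ
-- Both sequences are constant and their distance computes to `0ℚ`.
2*½≈1 = mk≈ λ 0<e → 0 , λ _ _ → 0<e

÷-cancel : ∀ x y (y#0 : y # 0ℝ) → (x ÷ y [ y#0 ]) * y ≈ x
÷-cancel x y y#0 = begin
  x * inverse y y#0 * y    ≈⟨ solve 3 (λ x y z → x :* z :* y := x :* (y :* z)) ≈-refl x y _ ⟩
  x * (y * inverse y y#0)  ≈⟨ *-congˡ (inverseʳ y y#0) ⟩
  x * 1ℝ                   ≈⟨ solve 1 (λ x → x :* con 1 := x) ≈-refl x ⟩
  x                        ∎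

j-recurrence : ∀ a b → Recurrence (coefficient a b) (j a b)
j-recurrence a b n = ≈-refl

j-suc-recurrence : ∀ a b → Recurrence (λ n → coefficient a b (suc n)) (λ n → j a b (suc n))
j-suc-recurrence a b n = ≈-refl

-- The convention j₋₁ = 1/2 is what extends the recurrence one step back: 1 = b · 0 + 2 · (1/2).
j-pred-recurrence : ∀ a b → Recurrence (λ n → coefficient a b (suc n)) (j-pred a b)
j-pred-recurrence a b (suc n) = ≈-refl
j-pred-recurrence a b zero    = begin
  1ℝ                    ≈⟨ 2*½≈1 ⟨
  2ℝ * ½ℝ               ≈⟨ solve 2 (λ b t → t := b :* con 0 :+ t) ≈-refl b (2ℝ * ½ℝ) ⟩
  b * 0ℝ + 2ℝ * ½ℝ      ∎

module _ (a b : ℝ) (a#0 : a # 0ℝ) where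

  private
    r : ℝ
    r = b ÷ a [ a#0 ]

    r*a≈b : r * a ≈ b
    r*a≈b = ÷-cancel b a a#0

  -- For either parity this reduces to (b/a) · a = b.
  ^ε-intertwines : ∀ n → r ^ ε n * coefficient a b (suc n) ≈ coefficient a b n * r ^ ε (suc n)
  ^ε-intertwines zero = begin
    1ℝ * b        ≈⟨ *-congˡ r*a≈b ⟨
    1ℝ * (r * a)  ≈⟨ solve 2 (λ r a → con 1 :* (r :* a) := a :* (r :* con 1)) ≈-refl r a ⟩
    a * (r * 1ℝ)  ∎
  ^ε-intertwines (suc zero) = begin
    r * 1ℝ * a  ≈⟨ solve 2 (λ r a → r :* con 1 :* a := r :* a :* con 1) ≈-refl r a ⟩
    r * a * 1ℝ  ≈⟨ *-congʳ r*a≈b ⟩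
    b * 1ℝ      ∎
  ^ε-intertwines (suc (suc n)) = ^ε-intertwines n

  ^ε-recurrence : ∀ {x} → Recurrence (λ n → coefficient a b (suc n)) x →
                  Recurrence (coefficient a b) (λ n → r ^ ε n * x n)
  ^ε-recurrence {x} = recurrence-twist {w = λ n → r ^ ε n} {x = x} (λ _ → ≈-refl) ^ε-intertwines

  J₀₀ : ∀ n → J a b a#0 n zero zero ≈ r ^ ε n * j a b (suc n)
  -- Matrix sums and scalings compute entrywise, so the recurrence for an entry of `J` holds by
  -- `≈-refl`.
  J₀₀ = recurrence-unique (λ _ → ≈-refl) (^ε-recurrence (j-suc-recurrence a b))
    (solve 0 (con 1 := con 1 :* con 1) ≈-refl)
    (begin
      -- At n = 1 the claimed entry involves j₂, which unfolds to a · 1 + 2 · 0.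
      b                              ≈⟨ r*a≈b ⟨
      r * a                          ≈⟨ solve 3 (λ r a t → r :* a := r :* con 1 :* (a :* con 1 :+ t :* con 0))
                                          ≈-refl r a 2ℝ ⟩
      r * 1ℝ * (a * 1ℝ + 2ℝ * 0ℝ)    ∎)

  J₀₁ : ∀ n → J a b a#0 n zero (suc zero) ≈ 2ℝ * r * j a b n
  J₀₁ = recurrence-unique (λ _ → ≈-refl) (recurrence-scale (2ℝ * r) (j-recurrence a b))
    (solve 1 (λ k → con 0 := k :* con 0) ≈-refl (2ℝ * r))
    (solve 1 (λ k → k := k :* con 1) ≈-refl (2ℝ * r))

  J₁₀ : ∀ n → J a b a#0 n (suc zero) zero ≈ j a b n
  J₁₀ = recurrence-unique (λ _ → ≈-refl) (j-recurrence a b) ≈-refl ≈-refl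

  J₁₁ : ∀ n → J a b a#0 n (suc zero) (suc zero) ≈ 2ℝ * r ^ ε n * j-pred a b n
  J₁₁ n = ≈-trans
    (recurrence-unique {x = λ n → J a b a#0 n (suc zero) (suc zero)} (λ _ → ≈-refl)
      (recurrence-scale 2ℝ (^ε-recurrence (j-pred-recurrence a b)))
      (begin
        1ℝ                ≈⟨ 2*½≈1 ⟨
        2ℝ * ½ℝ           ≈⟨ solve 2 (λ t h → t :* h := t :* (con 1 :* h)) ≈-refl 2ℝ ½ℝ ⟩
        2ℝ * (1ℝ * ½ℝ)    ∎)
      (solve 2 (λ t r → con 0 := t :* (r :* con 1 :* con 0)) ≈-refl 2ℝ r)
      n)
    -- Scaling leaves the factor 2 outside the twisted product; reassociate to the claimed form.
    (solve 3 (λ t w x → t :* (w :* x) := t :* w :* x) ≈-refl 2ℝ (r ^ ε n) (j-pred a b n))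

theorem2 : (a b : ℝ) (a#0 : a # 0ℝ) (b#0 : b # 0ℝ) (n : ℕ) →
    J a b a#0 n ≈ᴹ
    matrix₂ ((b ÷ a [ a#0 ]) ^ ε n * j a b (suc n))  (2ℝ * (b ÷ a [ a#0 ]) * j a b n)
    (j a b n)                                (2ℝ * (b ÷ a [ a#0 ]) ^ ε n * j-pred a b n)
theorem2 a b a#0 b#0 n zero       zero       = J₀₀ a b a#0 n
theorem2 a b a#0 b#0 n zero       (suc zero) = J₀₁ a b a#0 n
theorem2 a b a#0 b#0 n (suc zero) zero       = J₁₀ a b a#0 n
theorem2 a b a#0 b#0 n (suc zero) (suc zero) = J₁₁ a b a#0 n
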